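{- Let $\{P_n(x)\}_{n\ge 0}$ be a $d$-orthogonal polynomial sequence, with respect to the vector functional $(\mathcal L_0,\dots,\mathcal L_{d-1})$, with $\deg P_n=n$ and leading coefficient $[x^n]P_n(x)\neq 0$. Let $A=(a_{n,k})_{n,k\ge 0}$ be its coefficient matrix defined by $P_n(x)=\sum_{k=0}^n a_{n,k}x^k$. Then the following hold. (i) The matrix $A$ is lower triangular with nonzero diagonal entries, hence invertible, and $A^{ -1}$ exists. (ii) The production matrix $P$ of $A^{ -1}$, $P=A\,\overline{A^{ -1}}$ (where $\overline{A^{ -1}}$ is $A^{ -1}$ with its first row removed), is a $(d+2)$-banded (lower Hessenberg) matrix, i.e. $P_{i,j}=0$ for $j>i+1$ or $i-j>d$. (iii) The matrix $P$ encodes the $(d+2)$-term recurrence relation of $\{P_n(x)\}$: $$xP_n(x)=P_{n+1}(x)+\beta_nP_n(x)+\sum_{k=1}^{d}\gamma_{n,k}P_{n-k}(x),\qquad n\ge d,$$ where the coefficients $\beta_n,\gamma_{n,k}$ are given by the entries of $P$. (iv) The first $d$ columns of $A^{ -1}$ represent the moments of the vector functional $(\mathcal L_0,\dots,\mathcal L_{d-1})$, namely $$(A^{ -1})_{n,r}=\langle\mathcal L_r,x^n\rangle,\qquad r=0,1,\dots,d-1,\quad n\ge 0.$$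
   Context: Let $\mathbb P$ be the space of polynomials over $\mathbb C$ and let $\mathcal L_0,\dots,\mathcal L_{d-1}$ be $d$ linear functionals on $\mathbb P$; $\langle\mathcal L,p\rangle$ denotes the value of $\mathcal L$ on $p$. A monic polynomial sequence $\{P_n(x)\}_{n\ge 0}$ is called $d$-orthogonal with respect to the vector functional $(\mathcal L_0,\dots,\mathcal L_{d-1})$ if, for every $r=0,1,\dots,d-1$ and all $m\ge 0$, $\langle\mathcal L_r,x^mP_n(x)\rangle=0$ whenever $n\ge md+r+1$, and $\langle\mathcal L_r,x^mP_{md+r}(x)\rangle\neq 0$. For an invertible infinite lower triangular matrix $B$, the production matrix associated with $B$ is $B^{ -1}SB$, where $S=(\delta_{i+1,j})_{i,j\ge 0}$ is the shift matrix; $SB$ is $B$ with its first row removed. The notation $[x^n]P_n(x)$ means the coefficient of $x^n$ in $P_n(x)$.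
   Formalization: Part (iv) is proved under the added normalisation ⟨L_r,P_s⟩ = δ_{rs} for r,s<d; without it (iv) fails (for d=1, replacing L_0 by 2L_0 keeps d-orthogonality but changes the moments), and (iv) holds exactly when it is satisfied. -}

module Defs where

open import Algebra.Apartness.Bundles using (HeytingField; HeytingCommutativeRing)
open import Algebra.Bundles using (CommutativeRing)
open import Algebra.Definitions.RawMonoid as Sum using ()
open import Algebra.Module.Bundles using (LeftModule)
open import Algebra.Module.Construct.TensorUnit as TensorUnit using ()
open import Algebra.Module.Morphism.Structures using (module LeftModuleMorphisms)
open import Data.Bool.Base using (if_then_else_)
open import Data.Fin.Base using (Fin; toℕ)
open import Data.List.Base using (List; []; _∷_; map)
open import Data.Nat.Base as ℕ using (ℕ; zero; suc; _≤_; _<_; _∸_; _≡ᵇ_)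
open import Data.Product.Base using (_×_; _,_)
open import Data.Sum.Base using (_⊎_)
open import Level using (_⊔_)
import Algebra.Properties.Ring as RingProperties

module OverField {c ℓ₁ ℓ₂} (K : HeytingField c ℓ₁ ℓ₂) where

  open HeytingField K

  commutativeRing : CommutativeRing c ℓ₁
  commutativeRing = HeytingCommutativeRing.commutativeRing heytingCommutativeRing

  open CommutativeRing commutativeRing using (ring; rawRing; +-rawMonoid)
  open RingProperties ring using (-0#≈0#)

  -- A polynomial is its list of coefficients, constant term first.  Trailing
  -- zeros are allowed, so polynomials are compared coefficientwise by _≈ₚ_.
  Poly : Set c
  Poly = List Carrier

  coeff : Poly → ℕ → Carrier
  coeff []      _       = 0#
  coeff (a ∷ p) zero    = a
  coeff (a ∷ p) (suc k) = coeff p k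

  infix 4 _≈ₚ_
  _≈ₚ_ : Poly → Poly → Set ℓ₁
  p ≈ₚ q = ∀ k → coeff p k ≈ coeff q k

  infixl 6 _+ₚ_
  _+ₚ_ : Poly → Poly → Poly
  []      +ₚ q       = q
  (a ∷ p) +ₚ []      = a ∷ p
  (a ∷ p) +ₚ (b ∷ q) = (a + b) ∷ (p +ₚ q)

  -ₚ_ : Poly → Poly
  -ₚ_ = map (-_)

  infixr 7 _·ₚ_
  _·ₚ_ : Carrier → Poly → Poly
  a ·ₚ p = map (a *_) p

  1ₚ : Poly
  1ₚ = 1# ∷ []

  -- x^[ m ] p is the product x ᵐ p.
  x^[_]_ : ℕ → Poly → Poly
  x^[ zero  ] p = p
  x^[ suc m ] p = 0# ∷ x^[ m ] p

  coeff-+ : ∀ p q k → coeff (p +ₚ q) k ≈ coeff p k + coeff q k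
  coeff-+ []      q       k       = sym (+-identityˡ _)
  coeff-+ (a ∷ p) []      k       = sym (+-identityʳ _)
  coeff-+ (a ∷ p) (b ∷ q) zero    = refl
  coeff-+ (a ∷ p) (b ∷ q) (suc k) = coeff-+ p q k

  coeff-- : ∀ p k → coeff (-ₚ p) k ≈ - coeff p k
  coeff-- []      k       = sym -0#≈0#
  coeff-- (a ∷ p) zero    = refl
  coeff-- (a ∷ p) (suc k) = coeff-- p k

  coeff-· : ∀ a p k → coeff (a ·ₚ p) k ≈ a * coeff p k
  coeff-· a []      k       = sym (zeroʳ a)
  coeff-· a (b ∷ p) zero    = refl
  coeff-· a (b ∷ p) (suc k) = coeff-· a p k

  private
    +ₚ-cong : ∀ {p p′ q q′} → p ≈ₚ p′ → q ≈ₚ q′ → p +ₚ q ≈ₚ p′ +ₚ q′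
    +ₚ-cong {p} {p′} {q} {q′} e f k =
      trans (coeff-+ p q k) (trans (+-cong (e k) (f k)) (sym (coeff-+ p′ q′ k)))

    +ₚ-comm : ∀ p q → p +ₚ q ≈ₚ q +ₚ p
    +ₚ-comm p q k =
      trans (coeff-+ p q k) (trans (+-comm _ _) (sym (coeff-+ q p k)))

    +ₚ-assoc : ∀ p q s → (p +ₚ q) +ₚ s ≈ₚ p +ₚ (q +ₚ s)
    +ₚ-assoc p q s k =
      trans (coeff-+ (p +ₚ q) s k) (trans (+-cong (coeff-+ p q k) refl)
        (trans (+-assoc _ _ _) (sym (trans (coeff-+ p (q +ₚ s) k)
          (+-cong refl (coeff-+ q s k))))))

    +ₚ-identityʳ : ∀ p → p +ₚ [] ≈ₚ p
    +ₚ-identityʳ p k = trans (coeff-+ p [] k) (+-identityʳ _)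

    -ₚ-inverseˡ : ∀ p → (-ₚ p) +ₚ p ≈ₚ []
    -ₚ-inverseˡ p k =
      trans (coeff-+ (-ₚ p) p k) (trans (+-cong (coeff-- p k) refl) (-‿inverseˡ _))

    -ₚ-cong : ∀ {p q} → p ≈ₚ q → -ₚ p ≈ₚ -ₚ q
    -ₚ-cong {p} {q} e k =
      trans (coeff-- p k) (trans (-‿cong (e k)) (sym (coeff-- q k)))

    ·ₚ-cong : ∀ {a b p q} → a ≈ b → p ≈ₚ q → a ·ₚ p ≈ₚ b ·ₚ q
    ·ₚ-cong {a} {b} {p} {q} e f k =
      trans (coeff-· a p k) (trans (*-cong e (f k)) (sym (coeff-· b q k)))

    ·ₚ-zeroˡ : ∀ p → 0# ·ₚ p ≈ₚ []
    ·ₚ-zeroˡ p k = trans (coeff-· 0# p k) (zeroˡ _)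

    ·ₚ-identityˡ : ∀ p → 1# ·ₚ p ≈ₚ p
    ·ₚ-identityˡ p k = trans (coeff-· 1# p k) (*-identityˡ _)

    ·ₚ-assoc : ∀ a b p → (a * b) ·ₚ p ≈ₚ a ·ₚ (b ·ₚ p)
    ·ₚ-assoc a b p k =
      trans (coeff-· (a * b) p k) (trans (*-assoc _ _ _)
        (sym (trans (coeff-· a (b ·ₚ p) k) (*-cong refl (coeff-· b p k)))))

    ·ₚ-distribʳ : ∀ p a b → (a + b) ·ₚ p ≈ₚ (a ·ₚ p) +ₚ (b ·ₚ p)
    ·ₚ-distribʳ p a b k =
      trans (coeff-· (a + b) p k) (trans (distribʳ _ _ _)
        (sym (trans (coeff-+ (a ·ₚ p) (b ·ₚ p) k)
          (+-cong (coeff-· a p k) (coeff-· b p k)))))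

    ·ₚ-distribˡ : ∀ a p q → a ·ₚ (p +ₚ q) ≈ₚ (a ·ₚ p) +ₚ (a ·ₚ q)
    ·ₚ-distribˡ a p q k =
      trans (coeff-· a (p +ₚ q) k) (trans (*-cong refl (coeff-+ p q k))
        (trans (distribˡ _ _ _)
          (sym (trans (coeff-+ (a ·ₚ p) (a ·ₚ q) k)
            (+-cong (coeff-· a p k) (coeff-· a q k))))))

  polynomials : LeftModule ring c ℓ₁
  polynomials = record
    { Carrierᴹ = Poly
    ; _≈ᴹ_ = _≈ₚ_
    ; _+ᴹ_ = _+ₚ_
    ; _*ₗ_ = _·ₚ_
    ; 0ᴹ = []
    ; -ᴹ_ = -ₚ_
    ; isLeftModule = record
      { isLeftSemimodule = record
        { +ᴹ-isCommutativeMonoid = record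
          { isMonoid = record
            { isSemigroup = record
              { isMagma = record
                { isEquivalence = record
                  { refl  = λ _ → refl
                  ; sym   = λ e k → sym (e k)
                  ; trans = λ e f k → trans (e k) (f k)
                  }
                ; ∙-cong = λ {p} {p′} {q} {q′} → +ₚ-cong {p} {p′} {q} {q′}
                }
              ; assoc = +ₚ-assoc
              }
            ; identity = (λ _ _ → refl) , +ₚ-identityʳ
            }
          ; comm = +ₚ-comm
          }
        ; isPreleftSemimodule = record
          { *ₗ-cong      = λ {a} {b} {p} {q} → ·ₚ-cong {a} {b} {p} {q}
          ; *ₗ-zeroˡ     = ·ₚ-zeroˡ
          ; *ₗ-distribʳ  = ·ₚ-distribʳ
          ; *ₗ-identityˡ = ·ₚ-identityˡ
          ; *ₗ-assoc     = ·ₚ-assoc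
          ; *ₗ-zeroʳ     = λ _ _ → refl
          ; *ₗ-distribˡ  = ·ₚ-distribˡ
          }
        }
      ; -ᴹ‿cong    = λ {p} {q} → -ₚ-cong {p} {q}
      ; -ᴹ‿inverse = -ₚ-inverseˡ ,
                     λ p k → trans (+ₚ-comm p (-ₚ p) k) (-ₚ-inverseˡ p k)
      }
    }

  scalars : LeftModule ring c ℓ₁
  scalars = TensorUnit.leftModule

  record LinearFunctional : Set (c ⊔ ℓ₁) where
    field
      ⟦_⟧      : Poly → Carrier
      isLinear : LeftModuleMorphisms.IsLeftModuleHomomorphism
                   (LeftModule.rawLeftModule polynomials)
                   (LeftModule.rawLeftModule scalars) ⟦_⟧

  ⟨_,_⟩ : LinearFunctional → Poly → Carrier
  ⟨ ℒ , p ⟩ = LinearFunctional.⟦_⟧ ℒ p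

  ∑ : ∀ {n} → (Fin n → Carrier) → Carrier
  ∑ = Sum.sum +-rawMonoid

  ∑ₚ : ∀ {n} → (Fin n → Poly) → Poly
  ∑ₚ = Sum.sum (LeftModule.+ᴹ-rawMonoid polynomials)

  HasDegree : ℕ → Poly → Set (ℓ₁ ⊔ ℓ₂)
  HasDegree n p = (coeff p n # 0#) × (∀ k → n < k → coeff p k ≈ 0#)

  IsMonic : ℕ → Poly → Set (ℓ₁ ⊔ ℓ₂)
  IsMonic n p = HasDegree n p × coeff p n ≈ 1#

  record IsDOrthogonal (d : ℕ) (ℒ : Fin d → LinearFunctional)
                       (P : ℕ → Poly) : Set (ℓ₁ ⊔ ℓ₂) where
    field
      monic      : ∀ n → IsMonic n (P n)
      orthogonal : ∀ r m n → m ℕ.* d ℕ.+ toℕ r ℕ.+ 1 ≤ n →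
                   ⟨ ℒ r , x^[ m ] P n ⟩ ≈ 0#
      regular    : ∀ r m → ⟨ ℒ r , x^[ m ] P (m ℕ.* d ℕ.+ toℕ r) ⟩ # 0#

  Matrix : Set c
  Matrix = ℕ → ℕ → Carrier

  δ : Matrix
  δ i j = if i ≡ᵇ j then 1# else 0#

  -- d-orthogonality does not see nonzero rescaling of the functionals (or adding to ℒ r
  -- multiples of ℒ s with s < r); this picks the functionals of the dual
  -- sequence of P.
  IsNormalised : (d : ℕ) → (Fin d → LinearFunctional) → (ℕ → Poly) → Set ℓ₁
  IsNormalised d ℒ P = ∀ (r s : Fin d) → ⟨ ℒ r , P (toℕ s) ⟩ ≈ δ (toℕ r) (toℕ s)

  LowerTriangular : Matrix → Set ℓ₁
  LowerTriangular A = ∀ i j → i < j → A i j ≈ 0#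

  -- Row i of the left factor is cut off after column i, so this is the matrix
  -- product only when the left factor is lower triangular.
  infixl 7 _⊗_
  _⊗_ : Matrix → Matrix → Matrix
  (A ⊗ B) i j = ∑ {suc i} λ k → A i (toℕ k) * B (toℕ k) j

  infix 4 _≋_
  _≋_ : Matrix → Matrix → Set ℓ₁
  A ≋ B = ∀ i j → A i j ≈ B i j

  -- Inverses in the ring of lower triangular matrices.
  record IsInverse (A B : Matrix) : Set ℓ₁ where
    field
      lowerTriangular : LowerTriangular B
      rightInverse    : A ⊗ B ≋ δ
      leftInverse     : B ⊗ A ≋ δ

  removeFirstRow : Matrix → Matrix
  removeFirstRow B i j = B (suc i) j

  -- The production matrix of B, whose inverse B⁻¹ is passed explicitly.
  production : (B B⁻¹ : Matrix) → Matrix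
  production B B⁻¹ = B⁻¹ ⊗ removeFirstRow B

  -- The d + 2 diagonals j - i = 1, 0, …, -d.
  Banded : ℕ → Matrix → Set ℓ₁
  Banded d Π = ∀ i j → (i ℕ.+ 1 < j) ⊎ (j ℕ.+ d < i) → Π i j ≈ 0#

  coefficientMatrix : (ℕ → Poly) → Matrix
  coefficientMatrix P n k = coeff (P n) k

  -- The index k of the sum is shifted by one: suc (toℕ k) runs through 1, …, d.
  Recurrence : (d : ℕ) → (ℕ → Poly) → (β : ℕ → Carrier) (γ : ℕ → ℕ → Carrier) →
               Set ℓ₁
  Recurrence d P β γ = ∀ n → d ≤ n →
    x^[ 1 ] P n ≈ₚ P (n ℕ.+ 1) +ₚ β n ·ₚ P n
                   +ₚ ∑ₚ {d} (λ k → γ n (suc (toℕ k)) ·ₚ P (n ∸ suc (toℕ k)))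

{-# OPTIONS --safe #-}
-- The rows of A⁻¹ express the monomials, and the rows of Π = A · (A⁻¹ without
-- its first row) the products x Pₙ, in the basis (Pₖ).  If j = m d + r and
-- j + d < i, applying p ↦ ⟨ ℒ r , xᵐ p ⟩ to x Pᵢ = ∑ Π i k Pₖ kills the left
-- side and, by orthogonality, the terms k > j; the terms k < j vanish by
-- induction on j.  What remains is Π i j times a nonzero number, so Π i j = 0.
module Submission where

open import Defs
open import Algebra.Apartness.Bundles using (HeytingField)
open import Algebra.Bundles using (CommutativeRing)
open import Algebra.Module.Morphism.Structures using (module LeftModuleMorphisms)
open import Data.Fin.Base using (Fin; zero; suc; toℕ; fromℕ<)
open import Data.Fin.Properties using (toℕ<n; toℕ-fromℕ<)
open import Data.List.Base using (_∷_)
open import Data.Nat.Base as ℕ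
  using (ℕ; zero; suc; _≤_; _<_; z≤n; s≤s; z<s; s<s; NonZero; _∸_)
open import Data.Nat.DivMod using (DivMod; _divMod_; result)
open import Data.Nat.Induction using (<-rec)
open import Data.Nat.Properties as ℕₚ using ()
open import Data.Product.Base using (∃; _×_; _,_; proj₁; proj₂)
open import Data.Sum.Base using (inj₁; inj₂)
open import Function.Base using (_∘_)
open import Relation.Binary.Definitions using (tri<; tri≈; tri>)
open import Relation.Binary.PropositionalEquality as ≡ using (_≡_; _≢_)
open import Relation.Nullary.Decidable using (yes; no)
open import Relation.Nullary.Negation using (contradiction)
import Algebra.Properties.AbelianGroup as AbelianGroupProperties
import Algebra.Properties.Semiring.Sum as SemiringSum
import Relation.Binary.Reasoning.Setoid as ≈-Reasoning

module _ {c ℓ₁ ℓ₂} (K : HeytingField c ℓ₁ ℓ₂) where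

  open HeytingField K
  open OverField K
  open CommutativeRing commutativeRing using (+-abelianGroup; semiring)
  open AbelianGroupProperties +-abelianGroup using (xyx⁻¹≈y; ε⁻¹≈ε)
  open SemiringSum semiring
    using (sum-cong-≋; ∑-comm; *-distribˡ-sum; *-distribʳ-sum)
  open ≈-Reasoning setoid

  -- Arithmetic in a Heyting field.

  x-y≈x : ∀ {x y} → y ≈ 0# → x - y ≈ x
  x-y≈x y≈0 = trans (+-congˡ (trans (-‿cong y≈0) ε⁻¹≈ε)) (+-identityʳ _)

  -- Apartness from `0#` provides an inverse `z` of `y - 0#`, hence of `y`; multiplying the product
  -- by `z` isolates `x`.
  x*y≈0∧y#0⇒x≈0 : ∀ {x y} → x * y ≈ 0# → y # 0# → x ≈ 0#
  x*y≈0∧y#0⇒x≈0 {x} {y} xy≈0 y#0 with #⇒invertible y#0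
  ... | z , _ , [y-0]z≈1 = begin
    x                  ≈⟨ *-identityʳ x ⟨
    x * 1#             ≈⟨ *-congˡ [y-0]z≈1 ⟨
    x * ((y - 0#) * z) ≈⟨ *-congˡ (*-congʳ (x-y≈x refl)) ⟩
    x * (y * z)        ≈⟨ *-assoc x y z ⟨
    (x * y) * z        ≈⟨ *-congʳ xy≈0 ⟩
    0# * z             ≈⟨ zeroˡ z ⟩
    0#                 ∎

  x≈0⇒x*y≈0 : ∀ {x} y → x ≈ 0# → x * y ≈ 0#
  x≈0⇒x*y≈0 y x≈0 = trans (*-congʳ x≈0) (zeroˡ y)

  y≈0⇒x*y≈0 : ∀ x {y} → y ≈ 0# → x * y ≈ 0#
  y≈0⇒x*y≈0 x y≈0 = trans (*-congˡ y≈0) (zeroʳ x)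

  -- Finite sums over initial segments of the natural numbers.

  -- The summand lives on all of ℕ, so sums of different lengths can share it; truncation and
  -- reversal rely on this.
  ∑< : ℕ → (ℕ → Carrier) → Carrier
  ∑< n f = ∑ {n} λ k → f (toℕ k)

  ∑<-cong : ∀ n {f g : ℕ → Carrier} → (∀ k → k < n → f k ≈ g k) → ∑< n f ≈ ∑< n g
  ∑<-cong n f≈g = sum-cong-≋ {n} λ k → f≈g (toℕ k) (toℕ<n k)

  ∑<-congˡ : ∀ n (a : ℕ → Carrier) {f g : ℕ → Carrier} → (∀ k → k < n → f k ≈ g k) →
             ∑< n (λ k → a k * f k) ≈ ∑< n (λ k → a k * g k)
  ∑<-congˡ n a f≈g = ∑<-cong n λ k k<n → *-congˡ {a k} (f≈g k k<n)

  ∑<-zero : ∀ n {f : ℕ → Carrier} → (∀ k → k < n → f k ≈ 0#) → ∑< n f ≈ 0#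
  ∑<-zero zero    f≈0 = refl
  ∑<-zero (suc n) f≈0 = trans
    (+-cong (f≈0 0 z<s) (∑<-zero n λ k k<n → f≈0 (suc k) (s<s k<n)))
    (+-identityʳ 0#)

  ∑<-last : ∀ n f → ∑< (suc n) f ≈ ∑< n f + f n
  ∑<-last zero    f = +-comm _ _
  ∑<-last (suc n) f = trans (+-congˡ (∑<-last n (f ∘ suc))) (sym (+-assoc _ _ _))

  ∑<-truncate : ∀ {m n} {f : ℕ → Carrier} → m ≤ n →
                (∀ k → m ≤ k → k < n → f k ≈ 0#) → ∑< n f ≈ ∑< m f
  ∑<-truncate {n = n} z≤n f≈0 = ∑<-zero n λ k → f≈0 k z≤n
  ∑<-truncate (s≤s m≤n) f≈0 =
    +-congˡ (∑<-truncate m≤n λ k m≤k k<n → f≈0 (suc k) (s≤s m≤k) (s<s k<n))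

  ∑<-reverse : ∀ n f → ∑< n f ≈ ∑< n (λ k → f (n ∸ suc k))
  ∑<-reverse zero    f = refl
  ∑<-reverse (suc n) f = begin
    ∑< (suc n) f                     ≈⟨ ∑<-last n f ⟩
    ∑< n f + f n                     ≈⟨ +-comm _ _ ⟩
    f n + ∑< n f                     ≈⟨ +-congˡ (∑<-reverse n f) ⟩
    f n + ∑< n (λ k → f (n ∸ suc k)) ∎

  ∑<-single : ∀ {n j} {f : ℕ → Carrier} → j < n →
              (∀ k → k < n → k ≢ j → f k ≈ 0#) → ∑< n f ≈ f j
  ∑<-single {suc n} {zero} _ f≈0 = trans
    (+-congˡ (∑<-zero n λ k k<n → f≈0 (suc k) (s<s k<n) λ ()))
    (+-identityʳ _)
  ∑<-single {suc n} {suc j} (s≤s j<n) f≈0 = trans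
    (+-cong (f≈0 0 z<s λ ())
      (∑<-single j<n λ k k<n k≢j → f≈0 (suc k) (s<s k<n) (k≢j ∘ ℕₚ.suc-injective)))
    (+-identityˡ _)

  -- Distribute, exchange the sums, collect. The two lengths are independent, unlike in `⊗`, where
  -- the row index fixes the length; this leaves room for Hessenberg rows, which are one entry
  -- longer.
  ∑<-assoc : ∀ m n (u v : ℕ → Carrier) (B : Matrix) →
             ∑< n (λ k → ∑< m (λ l → u l * B l k) * v k) ≈
             ∑< m (λ l → u l * ∑< n (λ k → B l k * v k))
  ∑<-assoc m n u v B = begin
    ∑< n (λ k → ∑< m (λ l → u l * B l k) * v k)
      ≈⟨ ∑<-cong n (λ k _ → *-distribʳ-sum {m} (v k) λ l → u (toℕ l) * B (toℕ l) k) ⟩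
    ∑< n (λ k → ∑< m (λ l → u l * B l k * v k))
      ≈⟨ ∑-comm {n} {m} _ ⟩
    ∑< m (λ l → ∑< n (λ k → u l * B l k * v k))
      ≈⟨ ∑<-cong m (λ l _ → ∑<-cong n λ k _ → *-assoc (u l) (B l k) (v k)) ⟩
    ∑< m (λ l → ∑< n (λ k → u l * (B l k * v k)))
      ≈⟨ ∑<-cong m (λ l _ → sym (*-distribˡ-sum {n} (u l) λ k → B l (toℕ k) * v (toℕ k))) ⟩
    ∑< m (λ l → u l * ∑< n (λ k → B l k * v k)) ∎

  -- Lower triangular matrices and their product.

  δ-diagonal : ∀ i → δ i i ≈ 1#
  δ-diagonal zero    = refl
  δ-diagonal (suc i) = δ-diagonal i

  δ-offDiagonal : ∀ {i j} → i ≢ j → δ i j ≈ 0#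
  δ-offDiagonal {zero}  {zero}  0≢0 = contradiction ≡.refl 0≢0
  δ-offDiagonal {zero}  {suc j} _   = refl
  δ-offDiagonal {suc i} {zero}  _   = refl
  δ-offDiagonal {suc i} {suc j} i≢j = δ-offDiagonal (i≢j ∘ ≡.cong suc)

  ⊗-identityˡ : ∀ A → δ ⊗ A ≋ A
  ⊗-identityˡ A i j = begin
    (δ ⊗ A) i j   ≈⟨ ∑<-single (ℕₚ.n<1+n i)
                       (λ k _ k≢i → x≈0⇒x*y≈0 (A k j) (δ-offDiagonal (k≢i ∘ ≡.sym))) ⟩
    δ i i * A i j ≈⟨ *-congʳ (δ-diagonal i) ⟩
    1# * A i j    ≈⟨ *-identityˡ _ ⟩
    A i j         ∎

  -- For `j` beyond `i` the cut-off sum never reaches index `j` and is zero, so the entry of `A` has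
  -- to be zero there as well.
  ⊗-identityʳ : ∀ {A} → LowerTriangular A → A ⊗ δ ≋ A
  ⊗-identityʳ {A} A-lower i j with j ℕₚ.≤? i
  ... | yes j≤i = begin
    (A ⊗ δ) i j   ≈⟨ ∑<-single (s≤s j≤i)
                       (λ k _ k≢j → y≈0⇒x*y≈0 (A i k) (δ-offDiagonal k≢j)) ⟩
    A i j * δ j j ≈⟨ *-congˡ (δ-diagonal j) ⟩
    A i j * 1#    ≈⟨ *-identityʳ _ ⟩
    A i j         ∎
  ... | no j≰i = trans
    (∑<-zero (suc i) λ k k≤i → y≈0⇒x*y≈0 (A i k)
      (δ-offDiagonal (ℕₚ.<⇒≢ (ℕₚ.<-≤-trans k≤i (ℕₚ.≰⇒> j≰i)))))
    (sym (A-lower i j (ℕₚ.≰⇒> j≰i)))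

  -- Exchanging the sums leaves inner sums of `suc i` terms, while row `l` of `B ⊗ C` has only
  -- `suc l`; the surplus terms contain entries of `B` above the diagonal.
  ⊗-assoc : ∀ A {B} C → LowerTriangular B → (A ⊗ B) ⊗ C ≋ A ⊗ (B ⊗ C)
  ⊗-assoc A {B} C B-lower i j = trans
    (∑<-assoc (suc i) (suc i) (A i) (λ k → C k j) B)
    (∑<-congˡ (suc i) (A i) λ l l≤i →
      ∑<-truncate l≤i λ k l<k _ → x≈0⇒x*y≈0 (C k j) (B-lower l k l<k))

  ⊗-cong : ∀ {A A′ B B′} → A ≋ A′ → B ≋ B′ → A ⊗ B ≋ A′ ⊗ B′
  ⊗-cong A≋A′ B≋B′ i j = ∑<-cong (suc i) λ k _ → *-cong (A≋A′ i k) (B≋B′ k j)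

  -- Inversion of unitriangular matrices by forward substitution.

  UnitDiagonal : Matrix → Set ℓ₁
  UnitDiagonal A = ∀ i → A i i ≈ 1#

  module ForwardSubstitution (A : Matrix) where

    -- Row i is final after more than i steps.
    approximation : ℕ → Matrix
    approximation zero    = δ
    approximation (suc s) i j = δ i j - ∑< i λ k → A i k * approximation s k j

    -- Solves `A ⊗ X ≋ δ` row by row when the diagonal of `A` is 1, hence without division; `suc i`
    -- steps suffice for row `i`.
    inverse : Matrix
    inverse i = approximation (suc i) i

    -- Row `i` at one step refers only to rows `k < i` at the step before, so induction applies to
    -- both counters at once.
    approximation-stable : ∀ {s t i} j → i < s → i < t →
                           approximation s i j ≈ approximation t i j
    approximation-stable {suc s} {suc t} {i} j (s≤s i≤s) (s≤s i≤t) =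
      +-congˡ (-‿cong (∑<-congˡ i (A i) λ k k<i →
        approximation-stable j (ℕₚ.<-≤-trans k<i i≤s) (ℕₚ.<-≤-trans k<i i≤t)))

    approximation-lower : ∀ s → LowerTriangular (approximation s)
    approximation-lower zero    i j i<j = δ-offDiagonal (ℕₚ.<⇒≢ i<j)
    approximation-lower (suc s) i j i<j = trans
      (x-y≈x (∑<-zero i λ k k<i →
        y≈0⇒x*y≈0 (A i k) (approximation-lower s k j (ℕₚ.<-trans k<i i<j))))
      (δ-offDiagonal (ℕₚ.<⇒≢ i<j))

    inverse-lower : LowerTriangular inverse
    inverse-lower i = approximation-lower (suc i) i

    -- Allows the construction to be applied again, to the inverse itself. The correction on the
    -- diagonal involves only entries above the diagonal, which vanish.
    inverse-unit : UnitDiagonal inverse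
    inverse-unit i = trans
      (x-y≈x (∑<-zero i λ k k<i → y≈0⇒x*y≈0 (A i k) (approximation-lower i k i k<i)))
      (δ-diagonal i)

    inverseʳ : UnitDiagonal A → A ⊗ inverse ≋ δ
    inverseʳ A-unit i j = begin
      (A ⊗ inverse) i j               ≈⟨ ∑<-last i (λ k → A i k * inverse k j) ⟩
      Σ + A i i * inverse i j         ≈⟨ +-congˡ (*-congʳ (A-unit i)) ⟩
      Σ + 1# * inverse i j            ≈⟨ +-congˡ (*-identityˡ _) ⟩
      -- Unfolding `inverse i j` yields rows `k < i` taken after `i` steps, whereas `Σ` takes them
      -- after `suc k`; stability identifies the two.
      Σ + inverse i j                 ≈⟨ +-congˡ (+-congˡ (-‿cong
                                           (∑<-congˡ i (A i) λ k k<i →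
                                             approximation-stable j k<i (ℕₚ.n<1+n k)))) ⟩
      Σ + (δ i j - Σ)                 ≈⟨ +-assoc _ _ _ ⟨
      Σ + δ i j - Σ                   ≈⟨ xyx⁻¹≈y Σ (δ i j) ⟩
      δ i j                           ∎
      where Σ = ∑< i λ k → A i k * inverse k j

  -- A right inverse `B` has itself a right inverse `C`, and A = A(BC) = (AB)C = C; so BA = BC is
  -- the identity.
  unitriangular⇒invertible : ∀ {A} → LowerTriangular A → UnitDiagonal A → ∃ (IsInverse A)
  unitriangular⇒invertible {A} A-lower A-unit = B , record
    { lowerTriangular = B-lower
    ; rightInverse    = AB≋δ
    ; leftInverse     = λ i j → trans (⊗-cong {B} (λ _ _ → refl) A≋C i j) (BC≋δ i j)
    }
    where
    open ForwardSubstitution A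
      renaming (inverse to B; inverse-lower to B-lower; inverse-unit to B-unit)
    open ForwardSubstitution B using () renaming (inverse to C)
    AB≋δ : A ⊗ B ≋ δ
    AB≋δ = inverseʳ A-unit
    BC≋δ : B ⊗ C ≋ δ
    BC≋δ = ForwardSubstitution.inverseʳ B B-unit
    A≋C : A ≋ C
    A≋C i j = begin
      A i j               ≈⟨ ⊗-identityʳ A-lower i j ⟨
      (A ⊗ δ) i j         ≈⟨ ⊗-cong {A} (λ _ _ → refl) BC≋δ i j ⟨
      (A ⊗ (B ⊗ C)) i j   ≈⟨ ⊗-assoc A C B-lower i j ⟨
      ((A ⊗ B) ⊗ C) i j   ≈⟨ ⊗-cong {B = C} AB≋δ (λ _ _ → refl) i j ⟩
      (δ ⊗ C) i j         ≈⟨ ⊗-identityˡ C i j ⟩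
      C i j               ∎

  -- Linear combinations of polynomials and functionals applied to them.

  combination : ℕ → (ℕ → Carrier) → (ℕ → Poly) → Poly
  combination n a p = ∑ₚ {n} λ k → a (toℕ k) ·ₚ p (toℕ k)

  coeff-combination : ∀ n a p i →
                      coeff (combination n a p) i ≈ ∑< n (λ k → a k * coeff (p k) i)
  coeff-combination zero    a p i = refl
  coeff-combination (suc n) a p i = trans
    (coeff-+ (a 0 ·ₚ p 0) _ i)
    (+-cong (coeff-· (a 0) (p 0) i) (coeff-combination n (a ∘ suc) (p ∘ suc) i))

  coeff-x^1 : ∀ m j → coeff (x^[ m ] 1ₚ) j ≈ δ m j
  coeff-x^1 zero    zero    = refl
  coeff-x^1 zero    (suc j) = refl
  coeff-x^1 (suc m) zero    = refl
  coeff-x^1 (suc m) (suc j) = coeff-x^1 m j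

  x^-cong : ∀ m {p q} → p ≈ₚ q → x^[ m ] p ≈ₚ x^[ m ] q
  x^-cong zero    p≈q k       = p≈q k
  x^-cong (suc m) p≈q zero    = refl
  x^-cong (suc m) p≈q (suc k) = x^-cong m p≈q k

  x^-combination : ∀ m n a p →
                   x^[ m ] combination n a p ≈ₚ combination n a (λ k → x^[ m ] p k)
  x^-combination zero    n a p k       = refl
  x^-combination (suc m) n a p zero    = sym (trans
    (coeff-combination n a (λ k → x^[ suc m ] p k) 0) (∑<-zero n λ k _ → zeroʳ (a k)))
  x^-combination (suc m) n a p (suc i) = begin
    coeff (x^[ m ] combination n a p) i
      ≈⟨ x^-combination m n a p i ⟩
    coeff (combination n a (λ k → x^[ m ] p k)) i
      ≈⟨ coeff-combination n a (λ k → x^[ m ] p k) i ⟩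
    ∑< n (λ k → a k * coeff (x^[ m ] p k) i)
      ≈⟨ coeff-combination n a (λ k → x^[ suc m ] p k) (suc i) ⟨
    coeff (combination n a (λ k → x^[ suc m ] p k)) (suc i) ∎

  -- Merges the factor x on the left of the recurrence with the power of x used for testing.
  x^-sucʳ : ∀ m p → x^[ m ] (x^[ 1 ] p) ≡ x^[ suc m ] p
  x^-sucʳ zero    p = ≡.refl
  x^-sucʳ (suc m) p = ≡.cong (0# ∷_) (x^-sucʳ m p)

  module _ (ℒ : LinearFunctional) where

    open LinearFunctional ℒ using (isLinear)
    open LeftModuleMorphisms.IsLeftModuleHomomorphism isLinear
      using (⟦⟧-cong; +ᴹ-homo; 0ᴹ-homo; *ₗ-homo)

    functional-combination : ∀ n a p →
      ⟨ ℒ , combination n a p ⟩ ≈ ∑< n (λ k → a k * ⟨ ℒ , p k ⟩)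
    functional-combination zero    a p = 0ᴹ-homo
    functional-combination (suc n) a p = trans
      (+ᴹ-homo (a 0 ·ₚ p 0) _)
      (+-cong (*ₗ-homo (a 0) (p 0)) (functional-combination n (a ∘ suc) (p ∘ suc)))

    -- Turns an expansion of `q` into an equation between scalars: general `m` serves the band,
    -- `m = 0` the moments.
    functional-x^ : ∀ m n a p {q} → q ≈ₚ combination n a p →
      ⟨ ℒ , x^[ m ] q ⟩ ≈ ∑< n (λ k → a k * ⟨ ℒ , x^[ m ] p k ⟩)
    functional-x^ m n a p {q} q≈ = begin
      ⟨ ℒ , x^[ m ] q ⟩
        ≈⟨ ⟦⟧-cong (x^-cong m q≈) ⟩
      ⟨ ℒ , x^[ m ] combination n a p ⟩
        ≈⟨ ⟦⟧-cong (x^-combination m n a p) ⟩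
      ⟨ ℒ , combination n a (λ k → x^[ m ] p k) ⟩
        ≈⟨ functional-combination n a (λ k → x^[ m ] p k) ⟩
      ∑< n (λ k → a k * ⟨ ℒ , x^[ m ] p k ⟩) ∎

  -- Expansions in the polynomials of the sequence, and the recurrence.

  module InverseCoefficients
    (P : ℕ → Poly) (B : Matrix)
    (A-lower : LowerTriangular (coefficientMatrix P))
    (B-inverse : IsInverse (coefficientMatrix P) B) where

    open IsInverse B-inverse renaming (lowerTriangular to B-lower)

    A Π : Matrix
    A = coefficientMatrix P
    Π = production B A

    monomial-expansion : ∀ n → x^[ n ] 1ₚ ≈ₚ combination (suc n) (B n) P
    monomial-expansion n j = begin
      coeff (x^[ n ] 1ₚ) j                  ≈⟨ coeff-x^1 n j ⟩
      δ n j                                 ≈⟨ leftInverse n j ⟨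
      (B ⊗ A) n j                           ≈⟨ coeff-combination (suc n) (B n) P j ⟨
      coeff (combination (suc n) (B n) P) j ∎

    -- The matrix with entries `δ (suc k) j` is the shift S, so multiplication by x is right
    -- multiplication of `A` by S.
    coeff-x : ∀ n j → coeff (x^[ 1 ] P n) j ≈ ∑< (suc n) (λ k → A n k * δ (suc k) j)
    coeff-x n zero    = sym (∑<-zero (suc n) λ k _ → zeroʳ (A n k))
    coeff-x n (suc j) = sym (⊗-identityʳ A-lower n j)

    -- In matrices: AS = AS(BA) = (ASB)A, where SB is `B` without its first row and ASB is `Π`. Row
    -- `n` of `Π` reaches column `suc n`, so the last product cannot be written with `⊗`.
    x-expansion : ∀ n → x^[ 1 ] P n ≈ₚ combination (suc (suc n)) (Π n) P
    x-expansion n j = begin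
      coeff (x^[ 1 ] P n) j
        ≈⟨ coeff-x n j ⟩
      ∑< (suc n) (λ k → A n k * δ (suc k) j)
        ≈⟨ ∑<-congˡ (suc n) (A n) (λ k _ → leftInverse (suc k) j) ⟨
      ∑< (suc n) (λ k → A n k * (B ⊗ A) (suc k) j)
        -- Row `suc k` of the product has `suc (suc k)` terms; padding to `suc (suc n)` makes the
        -- length independent of `k`, so the sums can be exchanged.
        ≈⟨ ∑<-congˡ (suc n) (A n) (λ k k<1+n → ∑<-truncate (s≤s k<1+n)
             λ l k+1<l _ → x≈0⇒x*y≈0 (A l j) (B-lower (suc k) l k+1<l)) ⟨
      ∑< (suc n) (λ k → A n k * ∑< (suc (suc n)) (λ l → B (suc k) l * A l j))
        ≈⟨ ∑<-assoc (suc n) (suc (suc n)) (A n) (λ l → A l j) (removeFirstRow B) ⟨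
      ∑< (suc (suc n)) (λ l → Π n l * A l j)
        ≈⟨ coeff-combination (suc (suc n)) (Π n) P j ⟨
      coeff (combination (suc (suc n)) (Π n) P) j ∎

    Π-hessenberg : ∀ i j → suc i < j → Π i j ≈ 0#
    Π-hessenberg i j 1+i<j = ∑<-zero (suc i) λ k k≤i →
      y≈0⇒x*y≈0 (A i k) (B-lower (suc k) j (ℕₚ.≤-<-trans k≤i 1+i<j))

    -- Triangularity leaves one term, `A n n * B (suc n) (suc n)`. Monicity makes both diagonal
    -- entries of `A` equal, which turns it into a diagonal entry of `A ⊗ B`.
    Π-superdiagonal : UnitDiagonal A → ∀ n → Π n (suc n) ≈ 1#
    Π-superdiagonal A-unit n = begin
      Π n (suc n)
        ≈⟨ ∑<-single (ℕₚ.n<1+n n) (λ k k≤n k≢n → y≈0⇒x*y≈0 (A n k)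
             (B-lower (suc k) (suc n) (s<s (ℕₚ.≤∧≢⇒< (ℕₚ.≤-pred k≤n) k≢n)))) ⟩
      A n n * B (suc n) (suc n)
        ≈⟨ *-congʳ (A-unit n) ⟩
      1# * B (suc n) (suc n)
        ≈⟨ *-congʳ (A-unit (suc n)) ⟨
      A (suc n) (suc n) * B (suc n) (suc n)
        ≈⟨ ∑<-single (ℕₚ.n<1+n (suc n)) (λ k k≤1+n k≢1+n → y≈0⇒x*y≈0 (A (suc n) k)
             (B-lower k (suc n) (ℕₚ.≤∧≢⇒< (ℕₚ.≤-pred k≤1+n) k≢1+n))) ⟨
      (A ⊗ B) (suc n) (suc n)
        ≈⟨ rightInverse (suc n) (suc n) ⟩
      δ n n
        ≈⟨ δ-diagonal n ⟩
      1# ∎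

    -- The expansion of x Pₙ is split into its top term, its diagonal term and the columns below
    -- `n`, of which the band keeps `d`.
    banded⇒recurrence : ∀ {d} → UnitDiagonal A → Banded d Π →
                        Recurrence d P (λ n → Π n n) (λ n k → Π n (n ∸ k))
    banded⇒recurrence {d} A-unit Π-banded n d≤n j = begin
      coeff (x^[ 1 ] P n) j
        ≈⟨ x-expansion n j ⟩
      coeff (combination (suc (suc n)) (Π n) P) j
        ≈⟨ coeff-combination (suc (suc n)) (Π n) P j ⟩
      ∑< (suc (suc n)) f
        ≈⟨ ∑<-last (suc n) f ⟩
      ∑< (suc n) f + f (suc n)
        ≈⟨ +-cong (trans (∑<-last n f) (+-comm _ _))
             (trans (*-congʳ (Π-superdiagonal A-unit n)) (*-identityˡ _)) ⟩
      (f n + ∑< n f) + A (suc n) j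
        ≈⟨ +-comm _ _ ⟩
      A (suc n) j + (f n + ∑< n f)
        ≈⟨ +-assoc _ _ _ ⟨
      (A (suc n) j + f n) + ∑< n f
        ≈⟨ +-cong (+-congʳ (reflexive (≡.cong (λ k → A k j) (ℕₚ.+-comm 1 n)))) tail ⟩
      (A (n ℕ.+ 1) j + f n) + ∑< d (λ k → f (n ∸ suc k))
        ≈⟨ +-cong (+-congˡ (coeff-· (Π n n) (P n) j))
             (coeff-combination d (λ k → Π n (n ∸ suc k)) (λ k → P (n ∸ suc k)) j) ⟨
      (A (n ℕ.+ 1) j + coeff (Π n n ·ₚ P n) j) + coeff R j
        ≈⟨ +-congʳ (coeff-+ (P (n ℕ.+ 1)) (Π n n ·ₚ P n) j) ⟨
      coeff (P (n ℕ.+ 1) +ₚ Π n n ·ₚ P n) j + coeff R j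
        ≈⟨ coeff-+ (P (n ℕ.+ 1) +ₚ Π n n ·ₚ P n) R j ⟨
      coeff (P (n ℕ.+ 1) +ₚ Π n n ·ₚ P n +ₚ R) j ∎
      where
      f : ℕ → Carrier
      f k = Π n k * A k j

      R : Poly
      R = combination d (λ k → Π n (n ∸ suc k)) (λ k → P (n ∸ suc k))

      below-band : ∀ k → d ≤ k → k < n → (n ∸ suc k) ℕ.+ d < n
      below-band k d≤k k<n = ℕₚ.≤-trans
        (ℕₚ.≤-reflexive (≡.sym (ℕₚ.+-suc (n ∸ suc k) d)))
        (ℕₚ.≤-trans (ℕₚ.+-monoʳ-≤ (n ∸ suc k) (s≤s d≤k))
          (ℕₚ.≤-reflexive (ℕₚ.m∸n+n≡m k<n)))

      tail : ∑< n f ≈ ∑< d (λ k → f (n ∸ suc k))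
      -- Reversal numbers the columns by their distance from `n`, so those outside the band come
      -- last and are truncated.
      tail = trans (∑<-reverse n f) (∑<-truncate d≤n λ k d≤k k<n →
        x≈0⇒x*y≈0 (A (n ∸ suc k) j) (Π-banded n (n ∸ suc k) (inj₂ (below-band k d≤k k<n))))

  -- The band and the moments from d-orthogonality.

  module DOrthogonal
    (d : ℕ) .{{_ : NonZero d}} (ℒ : Fin d → LinearFunctional) (P : ℕ → Poly)
    (P-orthogonal : IsDOrthogonal d ℒ P) (B : Matrix)
    (A-lower : LowerTriangular (coefficientMatrix P))
    (B-inverse : IsInverse (coefficientMatrix P) B) where

    open IsDOrthogonal P-orthogonal
    open InverseCoefficients P B A-lower B-inverse
    open IsInverse B-inverse renaming (lowerTriangular to B-lower)

    orthogonal-below : ∀ r m {n} → m ℕ.* d ℕ.+ toℕ r < n → ⟨ ℒ r , x^[ m ] P n ⟩ ≈ 0#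
    orthogonal-below r m {n} j<n =
      orthogonal r m n (≡.subst (_≤ n) (ℕₚ.+-comm 1 _) j<n)

    Π-lower-step : ∀ i r m → let j = m ℕ.* d ℕ.+ toℕ r in
                   j ℕ.+ d < i → (∀ k → k < j → Π i k ≈ 0#) → Π i j ≈ 0#
    Π-lower-step i r m j+d<i Πik≈0 = x*y≈0∧y#0⇒x≈0 (begin
      Π i j * ⟨ ℒ r , x^[ m ] P j ⟩
        ≈⟨ ∑<-single j<2+i others ⟨
      ∑< (suc (suc i)) (λ k → Π i k * ⟨ ℒ r , x^[ m ] P k ⟩)
        ≈⟨ functional-x^ (ℒ r) m (suc (suc i)) (Π i) P (x-expansion i) ⟨
      ⟨ ℒ r , x^[ m ] (x^[ 1 ] P i) ⟩
        ≡⟨ ≡.cong (λ p → ⟨ ℒ r , p ⟩) (x^-sucʳ m (P i)) ⟩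
      ⟨ ℒ r , x^[ suc m ] P i ⟩
        -- Raising the exponent by one moves the orthogonality threshold from `j` to exactly
        -- `j + d`; this is where the bandwidth comes from.
        ≈⟨ orthogonal-below r (suc m) (≡.subst (_< i) j+d≡ j+d<i) ⟩
      0# ∎) (regular r m)
      where
      j = m ℕ.* d ℕ.+ toℕ r

      j+d≡ : j ℕ.+ d ≡ suc m ℕ.* d ℕ.+ toℕ r
      j+d≡ = ≡.trans (ℕₚ.+-comm j d) (≡.sym (ℕₚ.+-assoc d (m ℕ.* d) (toℕ r)))

      j<2+i : j < suc (suc i)
      j<2+i = ℕₚ.m<n⇒m<1+n (ℕₚ.m<n⇒m<1+n (ℕₚ.≤-<-trans (ℕₚ.m≤m+n j d) j+d<i))

      others : ∀ k → k < suc (suc i) → k ≢ j → Π i k * ⟨ ℒ r , x^[ m ] P k ⟩ ≈ 0#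
      others k _ k≢j with ℕₚ.<-cmp k j
      ... | tri< k<j _ _ = x≈0⇒x*y≈0 ⟨ ℒ r , x^[ m ] P k ⟩ (Πik≈0 k k<j)
      ... | tri≈ _ k≡j _ = contradiction k≡j k≢j
      ... | tri> _ _ j<k = y≈0⇒x*y≈0 (Π i k) (orthogonal-below r m j<k)

    -- Strong induction on the column; division of `j` by `d` selects the exponent and the
    -- functional that detect column `j`.
    Π-lower : ∀ i j → j ℕ.+ d < i → Π i j ≈ 0#
    Π-lower i = <-rec _ λ j rec j+d<i → step j rec j+d<i (j divMod d)
      where
      step : ∀ j → (∀ {k} → k < j → k ℕ.+ d < i → Π i k ≈ 0#) → j ℕ.+ d < i →
             DivMod j d → Π i j ≈ 0#
      step j rec j+d<i (result m r j≡r+md)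
        -- Division returns remainder plus multiple; commuting the sum before matching gives `j` the
        -- form used in the orthogonality conditions.
        with ≡.refl ← ≡.trans j≡r+md (ℕₚ.+-comm (toℕ r) (m ℕ.* d)) =
        Π-lower-step i r m j+d<i λ k k<j →
          rec k<j (ℕₚ.<-trans (ℕₚ.+-monoˡ-< d k<j) j+d<i)

    Π-banded : Banded d Π
    Π-banded i j (inj₁ i+1<j) = Π-hessenberg i j (≡.subst (_< j) (ℕₚ.+-comm i 1) i+1<j)
    Π-banded i j (inj₂ j+d<i) = Π-lower i j j+d<i

    -- Applying `ℒ r` to the expansion of xⁿ multiplies row `n` of `B` by column `r` of the
    -- identity.
    moments : IsNormalised d ℒ P → ∀ n (r : Fin d) → B n (toℕ r) ≈ ⟨ ℒ r , x^[ n ] 1ₚ ⟩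
    moments normalised n r = begin
      B n (toℕ r)                                ≈⟨ ⊗-identityʳ B-lower n (toℕ r) ⟨
      (B ⊗ δ) n (toℕ r)                          ≈⟨ ∑<-congˡ (suc n) (B n) (λ k _ → dual k) ⟨
      ∑< (suc n) (λ k → B n k * ⟨ ℒ r , P k ⟩)   ≈⟨ functional-x^ (ℒ r) 0 (suc n) (B n) P
                                                      (monomial-expansion n) ⟨
      ⟨ ℒ r , x^[ n ] 1ₚ ⟩                       ∎
      where
      δ-sym : ∀ i j → δ i j ≈ δ j i
      δ-sym zero    zero    = refl
      δ-sym zero    (suc j) = refl
      δ-sym (suc i) zero    = refl
      δ-sym (suc i) (suc j) = δ-sym i j

      -- Normalisation covers only indices below `d`; from `d` on, `toℕ r < k` and orthogonality
      -- with exponent 0 takes over.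
      dual : ∀ k → ⟨ ℒ r , P k ⟩ ≈ δ k (toℕ r)
      dual k with k ℕₚ.<? d
      ... | yes k<d = trans
        (≡.subst (λ s → ⟨ ℒ r , P s ⟩ ≈ δ (toℕ r) s) (toℕ-fromℕ< k<d)
          (normalised r (fromℕ< k<d)))
        (δ-sym (toℕ r) k)
      ... | no k≮d = trans
        (orthogonal-below r 0 r<k)
        (sym (δ-offDiagonal (ℕₚ.>⇒≢ r<k)))
        where
        r<k : toℕ r < k
        r<k = ℕₚ.<-≤-trans (toℕ<n r) (ℕₚ.≮⇒≥ k≮d)

theorem5p2 : ∀ {c ℓ₁ ℓ₂} (K : HeytingField c ℓ₁ ℓ₂) →
  let open HeytingField K
      open OverField K
  in
  (d : ℕ) .{{_ : NonZero d}} (ℒ : Fin d → LinearFunctional) (P : ℕ → Poly) →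
  IsDOrthogonal d ℒ P →
  (∀ n → HasDegree n (P n)) →
  let A = coefficientMatrix P in
  (LowerTriangular A × (∀ n → A n n # 0#) × ∃ (IsInverse A)) ×
  (∀ A⁻¹ → IsInverse A A⁻¹ →
    let Π = production A⁻¹ A in
    Banded d Π ×
    Recurrence d P (λ n → Π n n) (λ n k → Π n (n ∸ k)) ×
    (IsNormalised d ℒ P →
      ∀ n (r : Fin d) → A⁻¹ n (toℕ r) ≈ ⟨ ℒ r , x^[ n ] 1ₚ ⟩))
theorem5p2 K d ℒ P P-orthogonal P-degree =
  (A-lower , (λ n → proj₁ (P-degree n)) , unitriangular⇒invertible K A-lower A-unit) ,
  λ B B-inverse →
    let open InverseCoefficients K P B A-lower B-inverse
        open DOrthogonal K d ℒ P P-orthogonal B A-lower B-inverse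
    in Π-banded , banded⇒recurrence A-unit Π-banded , moments
  where
  open HeytingField K
  open OverField K

  A-lower : LowerTriangular (coefficientMatrix P)
  A-lower i = proj₂ (P-degree i)

  A-unit : UnitDiagonal K (coefficientMatrix P)
  A-unit n = proj₂ (IsDOrthogonal.monic P-orthogonal n)
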